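{- Let $D=(V,E)$ be a finite digraph. Then $D$ is an interval nest digraph if and only if $D$ is reflexive and there exists a nest ordering on $V$.
   Context: A digraph $D=(V,E)$ consists of a vertex set $V$ and an arc set $E\subseteq V\times V$ (loops allowed, no multiple arcs); $uv$ denotes the arc from $u$ to $v$. $D$ is reflexive if $uu\in E$ for every $u\in V$. $\mathcal{S}(E)$ denotes the set of symmetric arcs: $uv\in\mathcal{S}(E)$ means $uv\in E$ and $vu\in E$. $D$ is an interval nest digraph if there is a family $\{I_u,J_u\}_{u\in V}$ of (nonempty, bounded) closed intervals of the real line (single points allowed) such that $J_u\subseteq I_u$ for all $u\in V$ and, for all $u,v\in V$ (not necessarily distinct), $uv\in E$ if and only if $I_u\cap J_v\neq\emptyset$. A total ordering $\leq$ of the vertex set of a reflexive digraph $D=(V,E)$ is a nest ordering if for all $u\leq v\leq w\leq z$ in $V$ (repetitions allowed) all of the following hold: (i) If $uw,uz\in E$, then either $uv\in E$ or $vw,vz,wz\in\mathcal{S}(E)$. If $zu,zv\in E$, then either $zw\in E$ or $wu,vu,wv\in\mathcal{S}(E)$. (ii) If $uz,vw\in E$, then either $uw\in E$ or $vz\in E$. If $zu,wv\in E$, then either $zv\in E$ or $wu\in E$. (iii) If $uw,vz\in E$, then either $vw\in E$ or $uz\in E$. If $zv,wu\in E$, then either $zu\in E$ or $wv\in E$. ("Either ... or" is inclusive.) -}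

module Defs where

open import Level using (0ℓ)
open import Data.Fin.Base using (Fin)
open import Data.Nat.Base using (ℕ)
open import Data.Product.Base using (∃; ∃-syntax; _×_)
open import Data.Rational.Base as ℚ using (ℚ)
open import Data.Sum.Base using (_⊎_)
open import Function.Bundles using (_⇔_; _↔_)
open import Relation.Binary.Core using (Rel)
open import Relation.Binary.Definitions using (Decidable; Reflexive)
open import Relation.Binary.PropositionalEquality.Core using (_≡_)
open import Relation.Binary.Structures using (IsTotalOrder)
open import Relation.Nullary.Negation.Core using (¬_)
open import Relation.Unary using (Pred; Satisfiable; _⊆_; _≬_)

-- Real numbers as two-sided located Dedekind cuts of rationals:
-- Lower q is "q < x" and Upper q is "x < q".

record ℝ : Set₁ where
  field
    Lower           : Pred ℚ 0ℓ
    Upper           : Pred ℚ 0ℓ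
    lower-inhabited : Satisfiable Lower
    upper-inhabited : Satisfiable Upper
    lower-closed    : ∀ {q r} → q ℚ.< r → Lower r → Lower q
    lower-open      : ∀ {q} → Lower q → ∃[ r ] (q ℚ.< r × Lower r)
    upper-closed    : ∀ {q r} → q ℚ.< r → Upper q → Upper r
    upper-open      : ∀ {r} → Upper r → ∃[ q ] (q ℚ.< r × Upper q)
    disjoint        : ∀ {q} → ¬ (Lower q × Upper q)
    located         : ∀ {q r} → q ℚ.< r → Lower q ⊎ Upper r

infix 4 _≤ᵣ_

_≤ᵣ_ : Rel ℝ 0ℓ
x ≤ᵣ y = ℝ.Lower x ⊆ ℝ.Lower y

record Interval : Set₁ where
  field
    left       : ℝ
    right      : ℝ
    left≤right : left ≤ᵣ right

⟦_⟧ : Interval → Pred ℝ 0ℓ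
⟦ I ⟧ x = Interval.left I ≤ᵣ x × x ≤ᵣ Interval.right I

record Digraph : Set₁ where
  infix 4 _⟶_
  field
    Vertex : Set
    _⟶_    : Rel Vertex 0ℓ

-- In the absence of excluded middle, a set of arcs on a finite vertex set
-- is finite exactly when membership in it is decidable.

record IsFinite (D : Digraph) : Set where
  open Digraph D
  field
    order    : ℕ
    vertices : Vertex ↔ Fin order
    arc?     : Decidable _⟶_

module _ (D : Digraph) where
  open Digraph D

  IsReflexive : Set
  IsReflexive = Reflexive _⟶_

  𝒮 : Rel Vertex 0ℓ
  𝒮 u v = u ⟶ v × v ⟶ u

  -- P ≬ Q says that P and Q have a common element.

  record IsIntervalNestDigraph : Set₁ where
    field
      I       : Vertex → Interval
      J       : Vertex → Interval
      J⊆I     : ∀ u → ⟦ J u ⟧ ⊆ ⟦ I u ⟧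
      arc⇔I≬J : ∀ u v → u ⟶ v ⇔ ⟦ I u ⟧ ≬ ⟦ J v ⟧

  record IsNestOrdering (_≤_ : Rel Vertex 0ℓ) : Set where
    field
      isTotalOrder : IsTotalOrder _≡_ _≤_

      i-out   : ∀ {u v w z} → u ≤ v → v ≤ w → w ≤ z →
                u ⟶ w → u ⟶ z → u ⟶ v ⊎ (𝒮 v w × 𝒮 v z × 𝒮 w z)
      i-in    : ∀ {u v w z} → u ≤ v → v ≤ w → w ≤ z →
                z ⟶ u → z ⟶ v → z ⟶ w ⊎ (𝒮 w u × 𝒮 v u × 𝒮 w v)

      ii-out  : ∀ {u v w z} → u ≤ v → v ≤ w → w ≤ z →
                u ⟶ z → v ⟶ w → u ⟶ w ⊎ v ⟶ z
      ii-in   : ∀ {u v w z} → u ≤ v → v ≤ w → w ≤ z →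
                z ⟶ u → w ⟶ v → z ⟶ v ⊎ w ⟶ u

      iii-out : ∀ {u v w z} → u ≤ v → v ≤ w → w ≤ z →
                u ⟶ w → v ⟶ z → v ⟶ w ⊎ u ⟶ z
      iii-in  : ∀ {u v w z} → u ≤ v → v ≤ w → w ≤ z →
                z ⟶ v → w ⟶ u → z ⟶ u ⊎ w ⟶ v

  HasNestOrdering : Set₁
  HasNestOrdering = ∃ λ (_≤_ : Rel Vertex 0ℓ) → IsNestOrdering _≤_

{-# OPTIONS --safe #-}

-- Write I u = [l u, r u] and J u = [a u, b u], so that u → v iff l u ≤ b v and a v ≤ r u.
--
-- Ordering the vertices by a gives a nest ordering.  Comparing reals is not decidable, but
-- only finitely many orderings exist and being a nest ordering is decidable, so it suffices
-- to know that one is not impossible, and then the comparisons may be assumed decided.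
--
-- Conversely, given a nest ordering, let v be reached by u if v ≤ u or u → v.  The out-conditions
-- say that this is a Ferrers relation, so there are numbers a and r with a v ≤ r u iff u
-- reaches v; the in-conditions give b and l in the same way for the reversed order.  To
-- obtain l ≤ a ≤ b ≤ r as well, put r u just before the first vertex not reached by u, and a v
-- as far right as v and the r u with u reaching v allow; ties between vertices put in the
-- same gap are broken by the Ferrers relation.  By condition (i), both sides then fit together.
module Submission where

open import Defs
open import Data.Empty using (⊥-elim)
open import Data.Fin.Base as Fin using (Fin; combine; fromℕ<; toℕ)
open import Data.Fin.Properties as Fin using (all?; any?)
open import Data.Fin.Subset using (Subset; ∣_∣; ∁; _∈_)
open import Data.Fin.Subset.Properties
  using (p⊆q⇒∣p∣≤∣q∣; p⊂q⇒∣p∣<∣q∣; ∣p∣≤n; ∣∁p∣≡n∸∣p∣; x∈∁p⇒x∉p; x∉p⇒x∈∁p)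
open import Data.Integer.Base as ℤ using (ℤ; _⊖_)
open import Data.Integer.Properties as ℤ using (⊖-monoʳ-≥-≤; ⊖-monoʳ->-<)
open import Data.Nat.Base as ℕ using (ℕ; zero; suc; _+_; _*_; _∸_; s≤s)
open import Data.Nat.Coprimality using (1-coprimeTo) renaming (sym to coprime-sym)
open import Data.Nat.Properties as ℕ using (module ≤-Reasoning)
import Data.Nat.Tactic.RingSolver as RingSolver
open import Data.Product.Base using (∃; ∃-syntax; _×_; _,_; proj₁; proj₂)
open import Data.Rational.Base as ℚ using (ℚ; mkℚ; *≤*; *<*)
open import Data.Rational.Properties as ℚ using (<-dense)
open import Data.Sum.Base as Sum using (_⊎_; inj₁; inj₂; [_,_]′; map; swap)
open import Data.Vec.Base using (Vec; []; _∷_; lookup; tabulate)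
open import Data.Vec.Properties using (lookup∘tabulate; []=⇒lookup; lookup⇒[]=)
open import Effect.Monad using (RawMonad)
open import Function.Base using (_∘_; flip; id)
open import Function.Bundles using (_⇔_; _↔_; mk⇔; Inverse; Injection; Equivalence)
open import Function.Properties.Inverse using (Inverse⇒Injection)
open import Level using (0ℓ)
open import Relation.Binary.Consequences using (total∧dec⇒dec)
import Relation.Binary.Construct.Flip.EqAndOrd as Flip
open import Relation.Binary.Core using (Rel)
open import Relation.Binary.Definitions using (Decidable; tri<; tri≈; tri>)
open import Relation.Binary.PropositionalEquality
  using (_≡_; refl; sym; trans; cong; subst; subst₂; isEquivalence; module ≡-Reasoning)
open import Relation.Binary.Structures using (IsTotalOrder)
open import Relation.Nullary.Decidable
  using (Dec; yes; no; does; map′; ¬?; _×-dec_; _⊎-dec_; _→-dec_; decidable-stable;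
         ¬¬-excluded-middle; via-injection; dec-true)
open import Relation.Nullary.Negation using (¬_; contradiction; ¬¬-map; ¬¬-Monad)
import Relation.Unary as U
open import Relation.Unary using (Pred; _⊆_)

-- Counting decidable predicates on a finite set.

module Finite {V : Set} {n : ℕ} (V↔Fin : V ↔ Fin n) where

  open Inverse V↔Fin using (to; from; strictlyInverseʳ)

  _≟_ : Decidable {A = V} _≡_
  _≟_ = via-injection (Inverse⇒Injection V↔Fin) Fin._≟_

  ∀? : {P : Pred V 0ℓ} → U.Decidable P → Dec (∀ v → P v)
  ∀? {P} P? =
    map′ (λ p v → subst P (strictlyInverseʳ v) (p (to v))) (λ p → p ∘ from) (all? (P? ∘ from))

  ∃? : {P : Pred V 0ℓ} → U.Decidable P → Dec (∃ P)
  ∃? {P} P? =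
    map′ (λ (i , p) → from i , p) (λ (v , p) → to v , subst P (sym (strictlyInverseʳ v)) p)
      (any? (P? ∘ from))

  -- Finiteness lets double negation pass through the quantifier. This is what allows all
  -- comparisons of real endpoints to be assumed decided at once.
  ¬¬-sequence : {P : Pred V 0ℓ} → (∀ v → ¬ ¬ P v) → ¬ ¬ (∀ v → P v)
  ¬¬-sequence {P} p =
    ¬¬-map (λ q v → subst P (strictlyInverseʳ v) (q (to v)))
      (Fin.sequence (RawMonad.rawApplicative ¬¬-Monad) (p ∘ from))

  extent : {P : Pred V 0ℓ} → U.Decidable P → Subset n
  extent P? = tabulate (does ∘ P? ∘ from)

  module _ {P : Pred V 0ℓ} (P? : U.Decidable P) where

    ∈-extent⁺ : ∀ {i} → P (from i) → i ∈ extent P?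
    ∈-extent⁺ {i} p =
      lookup⇒[]= i _ (trans (lookup∘tabulate _ i) (dec-true (P? (from i)) p))

    ∈-extent⁻ : ∀ {i} → i ∈ extent P? → P (from i)
    ∈-extent⁻ {i} i∈
      with P? (from i) | trans (sym (lookup∘tabulate (does ∘ P? ∘ from) i)) ([]=⇒lookup i∈)
    ... | yes p | _ = p
    ... | no _  | ()

  # : {P : Pred V 0ℓ} → U.Decidable P → ℕ
  # P? = ∣ extent P? ∣

  module _ {P Q : Pred V 0ℓ} (P? : U.Decidable P) (Q? : U.Decidable Q) where

    #-mono : P ⊆ Q → # P? ℕ.≤ # Q?
    #-mono P⊆Q = p⊆q⇒∣p∣≤∣q∣ (∈-extent⁺ Q? ∘ P⊆Q ∘ ∈-extent⁻ P?)

    #-strictMono : P ⊆ Q → ∀ {v} → Q v → ¬ P v → # P? ℕ.< # Q?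
    #-strictMono P⊆Q {v} q ¬p = p⊂q⇒∣p∣<∣q∣
      ( ∈-extent⁺ Q? ∘ P⊆Q ∘ ∈-extent⁻ P?
      , to v
      , ∈-extent⁺ Q? (subst Q (sym (strictlyInverseʳ v)) q)
      , ¬p ∘ subst P (strictlyInverseʳ v) ∘ ∈-extent⁻ P?
      )

  module _ {P : Pred V 0ℓ} (P? : U.Decidable P) where

    #≤n : # P? ℕ.≤ n
    #≤n = ∣p∣≤n (extent P?)

    #-complement : # P? + # (¬? ∘ P?) ≡ n
    #-complement = begin
      # P? + # (¬? ∘ P?)        ≡⟨ cong (# P? +_) (ℕ.≤-antisym
        (p⊆q⇒∣p∣≤∣q∣ λ i∈ → x∉p⇒x∈∁p (∈-extent⁻ (¬? ∘ P?) i∈ ∘ ∈-extent⁻ P?))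
        (p⊆q⇒∣p∣≤∣q∣ λ i∈ → ∈-extent⁺ (¬? ∘ P?) (x∈∁p⇒x∉p i∈ ∘ ∈-extent⁺ P?))) ⟩
      # P? + ∣ ∁ (extent P?) ∣  ≡⟨ cong (# P? +_) (∣∁p∣≡n∸∣p∣ (extent P?)) ⟩
      # P? + (n ∸ # P?)         ≡⟨ ℕ.m+[n∸m]≡n #≤n ⟩
      n                         ∎
      where open ≡-Reasoning

  module _ {P Q : Pred V 0ℓ} (P? : U.Decidable P) (Q? : U.Decidable Q) where

    #-cover : (∀ v → P v ⊎ Q v) → n ℕ.≤ # P? + # Q?
    #-cover P∪Q = begin
      n                   ≡⟨ #-complement P? ⟨
      # P? + # (¬? ∘ P?)  ≤⟨ ℕ.+-monoʳ-≤ (# P?) (#-mono (¬? ∘ P?) Q? λ {v} ¬p →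
                               [ flip contradiction ¬p , id ]′ (P∪Q v)) ⟩
      # P? + # Q?         ∎
      where open ≤-Reasoning

    #-disjoint : (∀ {v} → P v → ¬ Q v) → ∀ {v} → ¬ P v → ¬ Q v → # P? + # Q? ℕ.< n
    #-disjoint P∩Q ¬p ¬q = begin-strict
      # P? + # Q?         <⟨ ℕ.+-monoʳ-< (# P?)
                               (#-strictMono Q? (¬? ∘ P?) (λ q p → P∩Q p q) ¬p ¬q) ⟩
      # P? + # (¬? ∘ P?)  ≡⟨ #-complement P? ⟩
      n                   ∎
      where open ≤-Reasoning

-- Dedekind reals and the embedding of the integers.

-- Openness of `y` leaves room for some `r` with `q < r < y`. Locating `x` between `q` and `r` gives
-- `q < x`, or else `x < r`, which would force `x ≤ᵣ y`.
≰ᵣ⇒≥ᵣ : ∀ {x y} → ¬ x ≤ᵣ y → y ≤ᵣ x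
≰ᵣ⇒≥ᵣ {x} {y} x≰y {q} q<y with ℝ.lower-open y q<y
... | r , q<r , r<y with ℝ.located x q<r
...   | inj₁ q<x = q<x
...   | inj₂ x<r = ⊥-elim (x≰y x≤y)
  where
  x≤y : x ≤ᵣ y
  x≤y {s} s<x with s ℚ.<? r
  ... | yes s<r = ℝ.lower-closed y s<r r<y
  ... | no s≮r with ℚ.<-cmp r s
  ...   | tri< r<s _ _ = ⊥-elim (ℝ.disjoint x (s<x , ℝ.upper-closed x r<s x<r))
  ...   | tri≈ _ refl _ = r<y
  ...   | tri> _ _ s<r = contradiction s<r s≮r

fromℚ : ℚ → ℝ
fromℚ p = record
  { Lower           = ℚ._< p
  ; Upper           = p ℚ.<_
  ; lower-inhabited = p ℚ.- ℚ.1ℚ , subst (p ℚ.- ℚ.1ℚ ℚ.<_) (ℚ.+-identityʳ p)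
                        (ℚ.+-monoʳ-< p (ℚ.negative⁻¹ (ℚ.- ℚ.1ℚ)))
  ; upper-inhabited = p ℚ.+ ℚ.1ℚ , subst (ℚ._< p ℚ.+ ℚ.1ℚ) (ℚ.+-identityʳ p)
                        (ℚ.+-monoʳ-< p (ℚ.positive⁻¹ ℚ.1ℚ))
  ; lower-closed    = ℚ.<-trans
  ; lower-open      = <-dense
  ; upper-closed    = flip ℚ.<-trans
  ; upper-open      = λ p<r → let q , p<q , q<r = <-dense p<r in q , q<r , p<q
  ; disjoint        = λ (q<p , p<q) → ℚ.<-asym q<p p<q
  ; located         = located
  }
  where
  located : ∀ {q r} → q ℚ.< r → q ℚ.< p ⊎ p ℚ.< r
  located {q} q<r with q ℚ.<? p
  ... | yes q<p = inj₁ q<p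
  ... | no  q≮p = inj₂ (ℚ.≤-<-trans (ℚ.≮⇒≥ q≮p) q<r)

fromℤ : ℤ → ℝ
fromℤ i = fromℚ (mkℚ i 0 (coprime-sym (1-coprimeTo ℤ.∣ i ∣)))

fromℤ-mono : ∀ {i j} → i ℤ.≤ j → fromℤ i ≤ᵣ fromℤ j
fromℤ-mono i≤j q<i = ℚ.<-≤-trans q<i (*≤* (ℤ.*-monoʳ-≤-nonNeg (ℤ.+ 1) i≤j))

-- If `j < i`, the rational `j` lies in the lower cut of `i` but not in its own.
fromℤ-cancel : ∀ {i j} → fromℤ i ≤ᵣ fromℤ j → i ℤ.≤ j
fromℤ-cancel {i} {j} ι≤ι = ℤ.≮⇒≥ λ j<i →
  ℚ.<-irrefl refl (ι≤ι (*<* (ℤ.*-monoʳ-<-pos (ℤ.+ 1) j<i)))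

m+k⊖m≡k : ∀ m k → (m + k) ⊖ m ≡ ℤ.+ k
m+k⊖m≡k m k = trans (ℤ.⊖-≥ (ℕ.m≤m+n m k)) (cong ℤ.+_ (ℕ.m+n∸m≡n m k))

m≤n+k⇒m⊖n≤k : ∀ {m k} n → m ℕ.≤ n + k → m ⊖ n ℤ.≤ ℤ.+ k
m≤n+k⇒m⊖n≤k {m} {k} n m≤n+k = subst (m ⊖ n ℤ.≤_) (m+k⊖m≡k n k) (ℤ.⊖-monoˡ-≤ n m≤n+k)

n+k≤m⇒k≤m⊖n : ∀ {m k} n → n + k ℕ.≤ m → ℤ.+ k ℤ.≤ m ⊖ n
n+k≤m⇒k≤m⊖n {m} {k} n n+k≤m = subst (ℤ._≤ m ⊖ n) (m+k⊖m≡k n k) (ℤ.⊖-monoˡ-≤ n n+k≤m)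

-- Endpoints read off from a total order.

module Cuts (D : Digraph) (fin : IsFinite D)
            (_≤_ : Rel (Digraph.Vertex D) 0ℓ) (_≤?_ : Decidable _≤_) where

  open Digraph D
  open IsFinite fin renaming (order to n)
  open Finite vertices

  -- Says that the right end of I u is not to the left of the left end of J v.
  Reaches : Rel Vertex 0ℓ
  Reaches u v = v ≤ u ⊎ u ⟶ v

  reaches? : Decidable Reaches
  reaches? u v = (v ≤? u) ⊎-dec arc? u v

  -- The coarse position of the right end of I u, resp. of the left end of J v, is given
  -- by the set of the vertices k to its left.
  Clear : Vertex → Pred Vertex 0ℓ
  Clear u k = ∀ x → x ≤ k → Reaches u x

  clear? : ∀ u → U.Decidable (Clear u)
  clear? u k = ∀? λ x → (x ≤? k) →-dec reaches? u x

  Before : Vertex → Pred Vertex 0ℓ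
  Before v k = ¬ v ≤ k × (∀ w → Reaches w v → Clear w k)

  before? : ∀ v → U.Decidable (Before v)
  before? v k = ¬? (v ≤? k) ×-dec ∀? λ w → reaches? w v →-dec clear? w k

  -- The w whose right end of I w lies strictly to the left of the left end of J v,
  -- resp. of the right end of I u.
  Missed : Vertex → Pred Vertex 0ℓ
  Missed v w = ¬ Reaches w v

  missed? : ∀ v → U.Decidable (Missed v)
  missed? v w = ¬? (reaches? w v)

  Overtaken : Vertex → Pred Vertex 0ℓ
  Overtaken u w = ∃[ v ] (Missed v w × Reaches u v)

  overtaken? : ∀ u → U.Decidable (Overtaken u)
  overtaken? u w = ∃? λ v → missed? v w ×-dec reaches? u v

  -- Lexicographic: n bounds each fine count, and the fine counts of both directions
  -- together must still fit into one coarse step.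
  scale : ℕ
  scale = n + n

  rightI : Vertex → ℕ
  rightI u = scale * # (clear? u) + # (overtaken? u)

  leftJ : Vertex → ℕ
  leftJ v = scale * # (before? v) + # (missed? v)

  leftJ≤rightI : ∀ {u v} → Reaches u v → leftJ v ℕ.≤ rightI u
  leftJ≤rightI {u} {v} u⇝v = ℕ.+-mono-≤
    (ℕ.*-monoʳ-≤ scale (#-mono (before? v) (clear? u) λ (_ , c) → c u u⇝v))
    (#-mono (missed? v) (overtaken? u) λ w↛v → v , w↛v , u⇝v)

-- Endpoint inequalities from the nest conditions.

module NestCuts (D : Digraph) (fin : IsFinite D)
                (_≤_ : Rel (Digraph.Vertex D) 0ℓ) (_≤?_ : Decidable _≤_)
                (nest : IsNestOrdering D _≤_) where

  open Digraph D
  open IsFinite fin renaming (order to n)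
  open Finite vertices
  open IsNestOrdering nest
  open IsTotalOrder isTotalOrder using (total) renaming (refl to ≤-refl; trans to ≤-trans)
  open Cuts D fin _≤_ _≤?_ public
  module Rev = Cuts D fin (flip _≤_) (flip _≤?_)

  ≰⇒≥ : ∀ {u v} → ¬ u ≤ v → v ≤ u
  ≰⇒≥ {u} {v} u≰v = [ flip contradiction u≰v , id ]′ (total u v)

  refine : ∀ {u v} → Reaches u v → v ≤ u ⊎ (u ≤ v × u ⟶ v)
  refine {u} {v} (inj₁ v≤u) = inj₁ v≤u
  refine {u} {v} (inj₂ u⟶v) = swap (map (_, u⟶v) id (total u v))

  -- Condition (i) is used at `u, v, w, z` if `u ⟶ w`, and otherwise at `u, w, z, z`, where the
  -- repeated vertex leaves only the symmetric alternative.
  leap : ∀ {u v w z} → u ≤ v → v ≤ w → w ≤ z → u ⟶ z → u ⟶ v ⊎ 𝒮 D w z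
  leap {u} {v} {w} {z} u≤v v≤w w≤z u⟶z with arc? u w
  ... | yes u⟶w = Sum.map₂ (λ (_ , _ , wz) → wz) (i-out u≤v v≤w w≤z u⟶w u⟶z)
  ... | no u↛w with i-out (≤-trans u≤v v≤w) w≤z ≤-refl u⟶z u⟶z
  ...   | inj₁ u⟶w        = contradiction u⟶w u↛w
  ...   | inj₂ (wz , _) = inj₂ wz

  -- In the remaining case `u ≤ x` and `w ≤ v`. Two order steps compose to `x ≤ u`, an order step
  -- and an arc are handled by `leap`, and two forward arcs fall under (ii) if nested and under
  -- (iii) if crossing.
  reaches-ferrers : ∀ {u v w x} → Reaches u v → Reaches w x → Reaches u x ⊎ Reaches w v
  reaches-ferrers {u} {v} {w} {x} u⇝v w⇝x with x ≤? u | v ≤? w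
  ... | yes x≤u | _ = inj₁ (inj₁ x≤u)
  ... | no _ | yes v≤w = inj₂ (inj₁ v≤w)
  ... | no x≰u | no v≰w = go (refine u⇝v) (refine w⇝x) (≰⇒≥ x≰u) (≰⇒≥ v≰w)
    where
    arcs : ∀ {u v w x} → u ≤ v → u ≤ x → w ≤ v → w ≤ x → u ⟶ v → w ⟶ x → u ⟶ x ⊎ w ⟶ v
    arcs {u} {v} {w} {x} u≤v u≤x w≤v w≤x u⟶v w⟶x with total u w | total v x
    ... | inj₁ u≤w | inj₁ v≤x = swap (iii-out u≤w w≤v v≤x u⟶v w⟶x)
    ... | inj₁ u≤w | inj₂ x≤v = ii-out u≤w w≤x x≤v u⟶v w⟶x
    ... | inj₂ w≤u | inj₁ v≤x = swap (ii-out w≤u u≤v v≤x w⟶x u⟶v)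
    ... | inj₂ w≤u | inj₂ x≤v = iii-out w≤u u≤x x≤v w⟶x u⟶v

    go : v ≤ u ⊎ (u ≤ v × u ⟶ v) → x ≤ w ⊎ (w ≤ x × w ⟶ x) → u ≤ x → w ≤ v →
         Reaches u x ⊎ Reaches w v
    go (inj₁ v≤u)         (inj₁ x≤w)         u≤x w≤v =
      inj₁ (inj₁ (≤-trans x≤w (≤-trans w≤v v≤u)))
    go (inj₁ v≤u)         (inj₂ (_ , w⟶x))   u≤x w≤v =
      swap (map inj₂ (inj₂ ∘ proj₁) (leap w≤v v≤u u≤x w⟶x))
    go (inj₂ (_ , u⟶v))   (inj₁ x≤w)         u≤x w≤v =
      map inj₂ (inj₂ ∘ proj₁) (leap u≤x x≤w w≤v u⟶v)
    go (inj₂ (u≤v , u⟶v)) (inj₂ (w≤x , w⟶x)) u≤x w≤v =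
      map inj₂ inj₂ (arcs u≤v u≤x w≤v w≤x u⟶v w⟶x)

  -- By the Ferrers property both counted sets on the left are contained in those on the right.
  -- Strictness comes from the fine count: `u` itself is in `Missed v` but not in `Overtaken u`.
  rightI<leftJ : ∀ {u v} → ¬ Reaches u v → rightI u ℕ.< leftJ v
  rightI<leftJ {u} {v} u↛v = ℕ.+-mono-≤-<
    (ℕ.*-monoʳ-≤ scale (#-mono (clear? u) (before? v) λ c →
      (λ v≤k → u↛v (c v v≤k)) ,
      λ w w⇝v x x≤k → [ flip contradiction u↛v , id ]′ (reaches-ferrers (c x x≤k) w⇝v)))
    (#-strictMono (overtaken? u) (missed? v) overtaken⇒missed u↛v
      λ (x , u↛x , u⇝x) → u↛x u⇝x)
    where
    overtaken⇒missed : Overtaken u ⊆ Missed v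
    overtaken⇒missed (x , w↛x , u⇝x) w⇝v = [ u↛v , w↛x ]′ (reaches-ferrers u⇝x w⇝v)

  -- This is what makes I v contain J v, although the two directions are built independently.
  clear⊎before : ∀ v k → Rev.Clear v k ⊎ Before v k
  clear⊎before v k with Rev.clear? v k
  ... | yes c = inj₁ c
  ... | no ¬c = inj₂
    ( (λ v≤k → ¬c λ x k≤x → inj₁ (≤-trans v≤k k≤x))
    , λ w w⇝v y y≤k → decidable-stable (reaches? w y) λ w↛y →
        ¬c λ x k≤x → decidable-stable (Rev.reaches? v x) λ v↛x →
        impossible w⇝v w↛y v↛x (≤-trans y≤k k≤x)
    )
    where
    -- In the arc case `w ≤ y ≤ x ≤ v`, and `leap` applied to `w ⟶ v` yields either `w ⟶ y` or
    -- `v ⟶ x`, both excluded.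
    impossible : ∀ {w x y} → Reaches w v → ¬ Reaches w y → ¬ Rev.Reaches v x → ¬ y ≤ x
    impossible (inj₁ v≤w) w↛y v↛x y≤x =
      w↛y (inj₁ (≤-trans y≤x (≤-trans (≰⇒≥ (v↛x ∘ inj₁)) v≤w)))
    impossible (inj₂ w⟶v) w↛y v↛x y≤x =
      [ w↛y ∘ inj₂ , (λ (_ , v⟶x) → v↛x (inj₂ v⟶x)) ]′
        (leap (≰⇒≥ (w↛y ∘ inj₁)) y≤x (≰⇒≥ (v↛x ∘ inj₁)) w⟶v)

  -- After reflection this becomes `lI≤aJ`. The coarse counts alone suffice, so the fine ones are
  -- dropped.
  scale*n≤rightI+leftJ : ∀ v → scale * n ℕ.≤ Rev.rightI v + leftJ v
  scale*n≤rightI+leftJ v = begin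
    scale * n              ≤⟨ ℕ.*-monoʳ-≤ scale (#-cover (Rev.clear? v) (before? v) (clear⊎before v)) ⟩
    scale * (c + b)        ≡⟨ ℕ.*-distribˡ-+ scale c b ⟩
    scale * c + scale * b  ≤⟨ ℕ.+-mono-≤ (ℕ.m≤m+n (scale * c) _) (ℕ.m≤m+n (scale * b) _) ⟩
    Rev.rightI v + leftJ v ∎
    where
    open ≤-Reasoning
    c = # (Rev.clear? v)
    b = # (before? v)

  -- After reflection this becomes `aJ≤bJ`. The two coarse sets are disjoint and both omit `v`, so
  -- one coarse step stays free to absorb the two fine counts.
  leftJ+leftJ≤scale*n : ∀ v → leftJ v + Rev.leftJ v ℕ.≤ scale * n
  leftJ+leftJ≤scale*n v = begin
    (scale * b + m) + (scale * b′ + m′)  ≡⟨ regroup scale b m b′ m′ ⟩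
    scale * (b + b′) + (m + m′)          ≤⟨ ℕ.+-monoʳ-≤ (scale * (b + b′)) m+m′≤scale ⟩
    scale * (b + b′) + scale             ≡⟨ ℕ.+-comm _ scale ⟩
    scale + scale * (b + b′)             ≡⟨ ℕ.*-suc scale (b + b′) ⟨
    scale * suc (b + b′)                 ≤⟨ ℕ.*-monoʳ-≤ scale b+b′<n ⟩
    scale * n                            ∎
    where
    open ≤-Reasoning
    b  = # (before? v)
    b′ = # (Rev.before? v)
    m  = # (missed? v)
    m′ = # (Rev.missed? v)

    opposite : ∀ {k} → Before v k → ¬ Rev.Before v k
    opposite (v≰k , _) (k≰v , _) = k≰v (≰⇒≥ v≰k)

    b+b′<n : b + b′ ℕ.< n
    b+b′<n = #-disjoint (before? v) (Rev.before? v) opposite {v}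
      (λ p → proj₁ p ≤-refl) (λ p → proj₁ p ≤-refl)

    m+m′≤scale : m + m′ ℕ.≤ scale
    m+m′≤scale = ℕ.+-mono-≤ (#≤n (missed? v)) (#≤n (Rev.missed? v))

    regroup : ∀ s b m b′ m′ → (s * b + m) + (s * b′ + m′) ≡ s * (b + b′) + (m + m′)
    regroup = RingSolver.solve-∀

-- Reading the four vertices backwards exchanges the out- and in-halves of each condition; in (iii)
-- the two alternatives trade places as well.
reverse : ∀ {D _≤_} → IsNestOrdering D _≤_ → IsNestOrdering D (flip _≤_)
reverse nest = record
  { isTotalOrder = Flip.isTotalOrder isTotalOrder
  ; i-out   = λ v≤u w≤v z≤w uw uz → Sum.map₂ (λ (vz , wz , vw) → vw , vz , wz) (i-in z≤w w≤v v≤u uz uw)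
  ; i-in    = λ v≤u w≤v z≤w zu zv → Sum.map₂ (λ (wv , wu , vu) → wu , vu , wv) (i-out z≤w w≤v v≤u zv zu)
  ; ii-out  = λ v≤u w≤v z≤w uz vw → ii-in z≤w w≤v v≤u uz vw
  ; ii-in   = λ v≤u w≤v z≤w zu wv → ii-out z≤w w≤v v≤u zu wv
  ; iii-out = λ v≤u w≤v z≤w uw vz → swap (iii-in z≤w w≤v v≤u uw vz)
  ; iii-in  = λ v≤u w≤v z≤w zv wu → swap (iii-out z≤w w≤v v≤u zv wu)
  }
  where open IsNestOrdering nest

-- Intervals from a nest ordering.

module Representation (D : Digraph) (fin : IsFinite D) (rfl : IsReflexive D)
                      (_≤_ : Rel (Digraph.Vertex D) 0ℓ) (nest : IsNestOrdering D _≤_) where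

  open Digraph D
  open IsFinite fin renaming (order to n)
  open Finite vertices using (_≟_)
  open IsTotalOrder (IsNestOrdering.isTotalOrder nest) using (total; antisym; reflexive)

  _≤?_ : Decidable _≤_
  _≤?_ = total∧dec⇒dec reflexive antisym total _≟_

  module ⟶ = NestCuts D fin _≤_ _≤?_ nest
  -- Flipping twice is definitionally the identity, so `⟶.Rev` agrees with the cuts of `⟵` and
  -- `⟵.Rev` with those of `⟶`.
  module ⟵ = NestCuts D fin (flip _≤_) (flip _≤?_) (reverse nest)

  total-width : ℕ
  total-width = ⟶.scale * n

  -- The reversed direction measures from the far end of the line, so its positions are reflected at
  -- `total-width`. They can fall below zero, since a fine count may push `⟵.rightI` past
  -- `total-width`.
  lI aJ bJ rI : Vertex → ℤ
  lI v = total-width ⊖ ⟵.rightI v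
  aJ v = ℤ.+ ⟶.leftJ v
  bJ v = total-width ⊖ ⟵.leftJ v
  rI v = ℤ.+ ⟶.rightI v

  lI≤aJ : ∀ v → lI v ℤ.≤ aJ v
  lI≤aJ v = m≤n+k⇒m⊖n≤k (⟵.rightI v) (⟶.scale*n≤rightI+leftJ v)

  aJ≤bJ : ∀ v → aJ v ℤ.≤ bJ v
  aJ≤bJ v = n+k≤m⇒k≤m⊖n (⟵.leftJ v) (⟵.leftJ+leftJ≤scale*n v)

  bJ≤rI : ∀ v → bJ v ℤ.≤ rI v
  bJ≤rI v = m≤n+k⇒m⊖n≤k (⟵.leftJ v)
    (subst (total-width ℕ.≤_) (ℕ.+-comm (⟶.rightI v) (⟵.leftJ v)) (⟵.scale*n≤rightI+leftJ v))

  I J : Vertex → Interval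
  I v = record
    { left       = fromℤ (lI v)
    ; right      = fromℤ (rI v)
    ; left≤right = fromℤ-mono (ℤ.≤-trans (lI≤aJ v) (ℤ.≤-trans (aJ≤bJ v) (bJ≤rI v)))
    }
  J v = record
    { left       = fromℤ (aJ v)
    ; right      = fromℤ (bJ v)
    ; left≤right = fromℤ-mono (aJ≤bJ v)
    }

  arc⇒aJ≤rI : ∀ {u v} → u ⟶ v → aJ v ℤ.≤ rI u
  arc⇒aJ≤rI u⟶v = ℤ.+≤+ (⟶.leftJ≤rightI (inj₂ u⟶v))

  arc⇒lI≤bJ : ∀ {u v} → u ⟶ v → lI u ℤ.≤ bJ v
  arc⇒lI≤bJ u⟶v = ⊖-monoʳ-≥-≤ total-width (⟵.leftJ≤rightI (inj₂ u⟶v))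

  aJ≤rI⇒reaches : ∀ {u v} → aJ v ℤ.≤ rI u → ⟶.Reaches u v
  aJ≤rI⇒reaches {u} {v} a≤r = decidable-stable (⟶.reaches? u v) λ u↛v →
    ℤ.≤⇒≯ a≤r (ℤ.+<+ (⟶.rightI<leftJ u↛v))

  lI≤bJ⇒reaches : ∀ {u v} → lI u ℤ.≤ bJ v → ⟵.Reaches u v
  lI≤bJ⇒reaches {u} {v} l≤b = decidable-stable (⟵.reaches? u v) λ u↛v →
    ℤ.≤⇒≯ l≤b (⊖-monoʳ->-< total-width (⟵.rightI<leftJ u↛v))

  overlap⇒arc : ∀ {u v} → lI u ℤ.≤ bJ v → aJ v ℤ.≤ rI u → u ⟶ v
  overlap⇒arc l≤b a≤r with aJ≤rI⇒reaches a≤r | lI≤bJ⇒reaches l≤b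
  ... | inj₂ u⟶v | _        = u⟶v
  ... | inj₁ _   | inj₂ u⟶v = u⟶v
  -- Neither side supplies an arc only at a single vertex, where reflexivity provides the loop.
  ... | inj₁ v≤u | inj₁ u≤v with refl ← antisym u≤v v≤u = rfl

  arc⇒meet : ∀ u v → u ⟶ v → ⟦ I u ⟧ U.≬ ⟦ J v ⟧
  arc⇒meet u v u⟶v with ℤ.≤-total (lI u) (aJ v)
  -- The common point is the larger of the two left endpoints.
  ... | inj₁ l≤a = fromℤ (aJ v) ,
    (fromℤ-mono l≤a , fromℤ-mono (arc⇒aJ≤rI u⟶v)) ,
    (λ {_} q → q) , fromℤ-mono (aJ≤bJ v)
  ... | inj₂ a≤l = fromℤ (lI u) ,
    ((λ {_} q → q) , Interval.left≤right (I u)) ,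
    (fromℤ-mono a≤l , fromℤ-mono (arc⇒lI≤bJ u⟶v))

  meet⇒arc : ∀ u v → ⟦ I u ⟧ U.≬ ⟦ J v ⟧ → u ⟶ v
  meet⇒arc u v (x , (l≤x , x≤r) , (a≤x , x≤b)) =
    overlap⇒arc (fromℤ-cancel λ {_} → x≤b ∘ l≤x) (fromℤ-cancel λ {_} → x≤r ∘ a≤x)

  isIntervalNestDigraph : IsIntervalNestDigraph D
  isIntervalNestDigraph = record
    { I       = I
    ; J       = J
    ; J⊆I     = λ u {x} (a≤x , x≤b) →
                  (λ {_} → a≤x ∘ fromℤ-mono (lI≤aJ u)) , λ {_} → fromℤ-mono (bJ≤rI u) ∘ x≤b
    ; arc⇔I≬J = λ u v → mk⇔ (arc⇒meet u v) (meet⇒arc u v)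
    }

-- A finite search space of orderings.

anyVec? : ∀ {m} k {P : Pred (Vec (Fin m) k) 0ℓ} → U.Decidable P → Dec (∃ P)
anyVec? zero    P? = map′ ([] ,_) (λ { ([] , p) → p }) (P? [])
anyVec? (suc k) P? =
  map′ (λ (x , xs , p) → x ∷ xs , p) (λ { (x ∷ xs , p) → x , xs , p })
    (any? λ x → anyVec? k (P? ∘ (x ∷_)))

module Order (D : Digraph) (fin : IsFinite D) where

  open Digraph D
  open IsFinite fin renaming (order to n)
  open Inverse vertices using (to; from; strictlyInverseʳ)
  open Finite vertices

  -- A finite stand-in for orderings that can be searched exhaustively. A rank will be a count of
  -- vertices, hence ranges over `0` to `n`.
  Ranking : Set
  Ranking = Vec (Fin (suc n)) n

  module _ (r : Ranking) where

    rank : Vertex → Fin (suc n)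
    rank v = lookup r (to v)

    -- The index of the vertex breaks ties of rank, so that every ranking gives an antisymmetric
    -- order.
    key : Vertex → Fin (suc n * n)
    key v = combine (rank v) (to v)

    _≼_ : Rel Vertex 0ℓ
    u ≼ v = key u Fin.≤ key v

    _≼?_ : Decidable _≼_
    u ≼? v = key u Fin.≤? key v

    ≼⇒rank≤ : ∀ {u v} → u ≼ v → rank u Fin.≤ rank v
    ≼⇒rank≤ {u} {v} u≼v = ℕ.≮⇒≥ λ rv<ru →
      ℕ.≤⇒≯ u≼v (Fin.combine-monoˡ-< (to v) (to u) rv<ru)

    ≼-isTotalOrder : IsTotalOrder _≡_ _≼_
    ≼-isTotalOrder = record
      { isPartialOrder = record
        { isPreorder = record
          { isEquivalence = isEquivalence
          ; reflexive     = λ { refl → ℕ.≤-refl }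
          ; trans         = ℕ.≤-trans
          }
        ; antisym = λ {u} {v} u≼v v≼u →
            Injection.injective (Inverse⇒Injection vertices)
              (Fin.combine-injectiveʳ (rank u) (to u) (rank v) (to v) (Fin.≤-antisym u≼v v≼u))
        }
      ; total = λ u v → ℕ.≤-total (toℕ (key u)) (toℕ (key v))
      }

  -- The first component is stronger than the out-halves of the nest conditions.
  LeftNest : Vertex → Vertex → Vertex → Vertex → Set
  LeftNest u v w z =
      (u ⟶ z → u ⟶ w)
    × (z ⟶ u → z ⟶ v → z ⟶ w ⊎ (𝒮 D w u × 𝒮 D v u × 𝒮 D w v))
    × (z ⟶ u → w ⟶ v → z ⟶ v ⊎ w ⟶ u)
    × (z ⟶ v → w ⟶ u → z ⟶ u ⊎ w ⟶ v)

  leftNest? : ∀ u v w z → Dec (LeftNest u v w z)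
  leftNest? u v w z =
          (arc? u z →-dec arc? u w)
    ×-dec (arc? z u →-dec arc? z v →-dec (arc? z w ⊎-dec (𝒮? w u ×-dec 𝒮? v u ×-dec 𝒮? w v)))
    ×-dec (arc? z u →-dec arc? w v →-dec (arc? z v ⊎-dec arc? w u))
    ×-dec (arc? z v →-dec arc? w u →-dec (arc? z u ⊎-dec arc? w v))
    where
    𝒮? : Decidable (𝒮 D)
    𝒮? u v = arc? u v ×-dec arc? v u

  IsLeftNest : Rel Vertex 0ℓ → Set
  IsLeftNest _≤_ = ∀ u v w z → u ≤ v → v ≤ w → w ≤ z → LeftNest u v w z

  isLeftNest? : ∀ {_≤_} → Decidable _≤_ → Dec (IsLeftNest _≤_)
  isLeftNest? _≤?_ = ∀? λ u → ∀? λ v → ∀? λ w → ∀? λ z →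
    (u ≤? v) →-dec (v ≤? w) →-dec (w ≤? z) →-dec leftNest? u v w z

  leftNest⇒nest : ∀ {_≤_} → IsTotalOrder _≡_ _≤_ → IsLeftNest _≤_ → IsNestOrdering D _≤_
  leftNest⇒nest {_≤_} isTotalOrder leftNest = record
    { isTotalOrder = isTotalOrder
    ; i-out   = λ u≤v v≤w w≤z uw uz → inj₁ (between u≤v v≤w uw)
    ; i-in    = λ u≤v v≤w w≤z → proj₁ (proj₂ (leftNest _ _ _ _ u≤v v≤w w≤z))
    ; ii-out  = λ u≤v v≤w w≤z uz vw → inj₁ (between (≤-trans u≤v v≤w) w≤z uz)
    ; ii-in   = λ u≤v v≤w w≤z → proj₁ (proj₂ (proj₂ (leftNest _ _ _ _ u≤v v≤w w≤z)))
    ; iii-out = λ u≤v v≤w w≤z uw vz → inj₁ (between v≤w w≤z vz)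
    ; iii-in  = λ u≤v v≤w w≤z → proj₂ (proj₂ (proj₂ (leftNest _ _ _ _ u≤v v≤w w≤z)))
    }
    where
    open IsTotalOrder isTotalOrder using () renaming (refl to ≤-refl; trans to ≤-trans)

    between : ∀ {u w z} → u ≤ w → w ≤ z → u ⟶ z → u ⟶ w
    between u≤w w≤z = proj₁ (leftNest _ _ _ _ ≤-refl u≤w w≤z)

  -- A nest ordering from intervals.

  module _ (representation : IsIntervalNestDigraph D) where

    open IsIntervalNestDigraph representation

    lI aJ bJ rI : Vertex → ℝ
    lI v = Interval.left (I v)
    aJ v = Interval.left (J v)
    bJ v = Interval.right (J v)
    rI v = Interval.right (I v)

    aJ≤bJ : ∀ v → aJ v ≤ᵣ bJ v
    aJ≤bJ v = Interval.left≤right (J v)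

    lI≤aJ : ∀ v → lI v ≤ᵣ aJ v
    lI≤aJ v = proj₁ (J⊆I v {aJ v} ((λ {_} q → q) , aJ≤bJ v))

    bJ≤rI : ∀ v → bJ v ≤ᵣ rI v
    bJ≤rI v = proj₂ (J⊆I v {bJ v} (aJ≤bJ v , λ {_} q → q))

    isReflexive : IsReflexive D
    isReflexive {u} = Equivalence.from (arc⇔I≬J u u)
      (aJ u , J⊆I u {aJ u} a∈J , a∈J)
      where
      a∈J : ⟦ J u ⟧ (aJ u)
      a∈J = (λ {_} q → q) , aJ≤bJ u

    arc⇒lI≤bJ : ∀ {u v} → u ⟶ v → lI u ≤ᵣ bJ v
    arc⇒lI≤bJ {u} {v} u⟶v with _ , (l≤x , _) , (_ , x≤b) ← Equivalence.to (arc⇔I≬J u v) u⟶v =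
      x≤b ∘ l≤x

    -- The common point is again the larger left endpoint. Arcs are decidable, hence stable, so the
    -- comparison of the two endpoints may be assumed decided.
    overlap⇒arc : ∀ {u v} → lI u ≤ᵣ bJ v → aJ v ≤ᵣ rI u → u ⟶ v
    overlap⇒arc {u} {v} l≤b a≤r = decidable-stable (arc? u v) λ u↛v →
      ¬¬-excluded-middle {A = lI u ≤ᵣ aJ v} λ
        { (yes l≤a) → u↛v (Equivalence.from (arc⇔I≬J u v)
            (aJ v , (l≤a , a≤r) , ((λ {_} q → q) , aJ≤bJ v)))
        ; (no l≰a) → u↛v (Equivalence.from (arc⇔I≬J u v)
            (lI u , ((λ {_} q → q) , Interval.left≤right (I u)) ,
                    (≰ᵣ⇒≥ᵣ {lI u} {aJ v} l≰a , l≤b)))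
        }

    module _ {_≤_ : Rel Vertex 0ℓ} (≤⇒aJ≤aJ : ∀ {u v} → u ≤ v → aJ u ≤ᵣ aJ v)
             (≤-trans : ∀ {u v w} → u ≤ v → v ≤ w → u ≤ w) where

      ≤⇒aJ≤rI : ∀ {u v} → u ≤ v → aJ u ≤ᵣ rI v
      ≤⇒aJ≤rI {u} {v} u≤v = bJ≤rI v ∘ aJ≤bJ v ∘ ≤⇒aJ≤aJ u≤v

      -- `aJ w ≤ᵣ rI z` holds by the order, so the arc can be missing only because `J w` lies to the
      -- left of `I z`.
      nonarc⇒bJ≤lI : ∀ {w z} → w ≤ z → ¬ z ⟶ w → bJ w ≤ᵣ lI z
      nonarc⇒bJ≤lI {w} {z} w≤z z↛w = ≰ᵣ⇒≥ᵣ {lI z} {bJ w} λ l≤b →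
        z↛w (overlap⇒arc l≤b (≤⇒aJ≤rI w≤z))

      -- Here `aJ v` lies in both `J u` and `J v`, hence in both `I u` and `I v`.
      symmetric : ∀ {u v} → u ≤ v → aJ v ≤ᵣ bJ u → 𝒮 D v u
      symmetric {u} {v} u≤v a≤b =
        overlap⇒arc (a≤b ∘ lI≤aJ v) (≤⇒aJ≤rI u≤v) ,
        overlap⇒arc (aJ≤bJ v ∘ ≤⇒aJ≤aJ u≤v ∘ lI≤aJ u) (bJ≤rI u ∘ a≤b)

      isLeftNest : IsLeftNest _≤_
      isLeftNest u v w z u≤v v≤w w≤z = between , i-in , ii-in , iii-in
        where
        u≤w = ≤-trans u≤v v≤w
        v≤z = ≤-trans v≤w w≤z
        u≤z = ≤-trans u≤v v≤z

        between : u ⟶ z → u ⟶ w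
        between uz with _ , (_ , x≤r) , (a≤x , _) ← Equivalence.to (arc⇔I≬J u z) uz =
          overlap⇒arc (aJ≤bJ w ∘ ≤⇒aJ≤aJ u≤w ∘ lI≤aJ u) (x≤r ∘ a≤x ∘ ≤⇒aJ≤aJ w≤z)

        i-in : z ⟶ u → z ⟶ v → z ⟶ w ⊎ (𝒮 D w u × 𝒮 D v u × 𝒮 D w v)
        i-in zu zv with arc? z w
        ... | yes zw = inj₁ zw
        ... | no z↛w = inj₂
          ( symmetric u≤w (w≤b zu)
          , symmetric u≤v (w≤b zu ∘ ≤⇒aJ≤aJ v≤w)
          , symmetric v≤w (w≤b zv)
          )
          where
          -- `J w` ends before `I z` begins, whereas `J x` extends as far as `I z`.
          w≤b : ∀ {x} → z ⟶ x → aJ w ≤ᵣ bJ x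
          w≤b zx = arc⇒lI≤bJ zx ∘ nonarc⇒bJ≤lI w≤z z↛w ∘ aJ≤bJ w

        ii-in : z ⟶ u → w ⟶ v → z ⟶ v ⊎ w ⟶ u
        ii-in zu wv with arc? z v
        ... | yes zv = inj₁ zv
        -- The chain is `lI w ≤ bJ v ≤ lI z ≤ bJ u`; exchanging `u` and `v` gives the one for
        -- `iii-in`.
        ... | no z↛v = inj₂ (overlap⇒arc
          (arc⇒lI≤bJ zu ∘ nonarc⇒bJ≤lI v≤z z↛v ∘ arc⇒lI≤bJ wv) (≤⇒aJ≤rI u≤w))

        iii-in : z ⟶ v → w ⟶ u → z ⟶ u ⊎ w ⟶ v
        iii-in zv wu with arc? z u
        ... | yes zu = inj₁ zu
        ... | no z↛u = inj₂ (overlap⇒arc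
          (arc⇒lI≤bJ zv ∘ nonarc⇒bJ≤lI u≤z z↛u ∘ arc⇒lI≤bJ wu) (≤⇒aJ≤rI v≤w))

    module _ (aJ≤aJ? : ∀ u v → Dec (aJ u ≤ᵣ aJ v)) where

      above? : ∀ u → U.Decidable (λ w → ¬ aJ u ≤ᵣ aJ w)
      above? u w = ¬? (aJ≤aJ? u w)

      ranking : Ranking
      ranking = tabulate λ i → fromℕ< (s≤s (#≤n (above? (from i))))

      rank-# : ∀ v → toℕ (rank ranking v) ≡ # (above? v)
      rank-# v = begin
        toℕ (rank ranking v)                                ≡⟨ cong toℕ (lookup∘tabulate _ (to v)) ⟩
        toℕ (fromℕ< (s≤s (#≤n (above? (from (to v))))))     ≡⟨ Fin.toℕ-fromℕ< _ ⟩
        # (above? (from (to v)))                            ≡⟨ cong (λ x → # (above? x)) (strictlyInverseʳ v) ⟩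
        # (above? v)                                        ∎
        where open ≡-Reasoning

      -- Were `aJ v` strictly to the left of `aJ u`, every vertex counted for `v` would be counted
      -- for `u`, and `v` in addition.
      #≤⇒aJ≤aJ : ∀ {u v} → # (above? u) ℕ.≤ # (above? v) → aJ u ≤ᵣ aJ v
      #≤⇒aJ≤aJ {u} {v} #u≤#v with aJ≤aJ? u v
      ... | yes u≤v = u≤v
      ... | no u≰v = ⊥-elim (ℕ.≤⇒≯ #u≤#v
        (#-strictMono (above? v) (above? u) (λ v≰w u≤w → v≰w λ {_} → u≤w ∘ ≰ᵣ⇒≥ᵣ {aJ u} {aJ v} u≰v)
          {v} u≰v λ v≰v → v≰v λ {_} q → q))

      ranking-leftNest : IsLeftNest (_≼_ ranking)
      ranking-leftNest = isLeftNest
        (λ {u} {v} u≼v → #≤⇒aJ≤aJ (subst₂ ℕ._≤_ (rank-# u) (rank-# v) (≼⇒rank≤ ranking {u} {v} u≼v)))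
        ℕ.≤-trans

    hasNestOrdering : HasNestOrdering D
    hasNestOrdering
      with r , leftNest ← decidable-stable (anyVec? n λ r → isLeftNest? (_≼?_ r))
             (¬¬-map (λ aJ≤aJ? → ranking aJ≤aJ? , ranking-leftNest aJ≤aJ?)
               (¬¬-sequence λ u → ¬¬-sequence λ v → ¬¬-excluded-middle)) =
      _≼_ r , leftNest⇒nest (≼-isTotalOrder r) leftNest

theorem1 : (D : Digraph) → IsFinite D → IsIntervalNestDigraph D ⇔ (IsReflexive D × HasNestOrdering D)
theorem1 D fin = mk⇔
  (λ rep → (λ {u} → Order.isReflexive D fin rep {u}) , Order.hasNestOrdering D fin rep)
  (λ (rfl , _≤_ , nest) → Representation.isIntervalNestDigraph D fin (λ {u} → rfl {u}) _≤_ nest)
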